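{- Let $N\ge 2$ be an integer and let $r,s\geq 1$ be integers. Let $C_1[0..r]$ and $C_2[0..s]$ be strictly increasing arrays of integers with $C_1[0] = C_2[0] = 0$ and $C_1[r] = C_2[s] = N$ (sorted change-point sets with the auxiliary change-points $0$ and $N$ added at both ends). Then the procedure RICPD (given in the context), on input $(C_1,C_2)$, returns the Rand Index between the clusterings $\{\{C_1[i]+1,\ldots,C_1[i+1]\} : 0\le i\le r-1\}$ and $\{\{C_2[j]+1,\ldots,C_2[j+1]\} : 0\le j\le s-1\}$ of $\{1,\ldots,N\}$. Moreover, it runs in $O(r+s)$ time and uses $O(1)$ auxiliary memory (beyond the input), with implied constants independent of $N$, $r$, $s$ and the input arrays.
   Context: A clustering of $\{1,\ldots,N\}$ is a partition of $\{1,\ldots,N\}$ into nonempty sets, called clusters. For a clustering $P$, let $I_P(i,j) = 1$ if $i$ and $j$ belong to the same cluster of $P$ and $I_P(i,j)=0$ otherwise. Given two clusterings $P_1,P_2$ of $\{1,\ldots,N\}$, let $N_{11}$ (respectively $N_{00}$) be the number of pairs $(i,j)\in\{1,\ldots,N\}^2$ with $i<j$ and $I_{P_1}(i,j)=I_{P_2}(i,j)=1$ (respectively $I_{P_1}(i,j)=I_{P_2}(i,j)=0$). The Rand Index between $P_1$ and $P_2$ is $RI = (N_{00}+N_{11})/\binom{N}{2}$. Procedure RICPD$(C_1,C_2)$: (1) Set $r \gets \mathrm{size}(C_1)-1$, $s\gets \mathrm{size}(C_2)-1$, $d\gets 0$, $b\gets 0$. (2) For $i = 0,1,\ldots,r-1$: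 for $j = b, b+1,\ldots,s-1$ (with $b$ taken at the value it has when this inner loop starts; the loop is empty if $b>s-1$), do: (a) $m\gets \min(C_1[i+1],C_2[j+1]) - \max(C_1[i],C_2[j])$; (b) $m\gets\max(0,m)$; (c) $d\gets d + m\,|C_1[i+1]-C_2[j+1]|$; (d) if $C_1[i+1]<C_2[j+1]$, break out of the inner loop (over $j$); otherwise set $b\gets j+1$. (3) Set $N\gets C_1[r]$ and return $1 - d/\binom{N}{2}$. Time is the number of elementary operations (arithmetic operations, comparisons, assignments, array accesses), each counted at unit cost; memory is the number of stored numbers. -}

module Defs where

open import Data.Bool.Base using (true; if_then_else_)
open import Data.Fin.Base as Fin using (Fin; zero; suc; toℕ; fromℕ; fromℕ<; inject₁)
open import Data.Fin.Patterns using (0F; 1F; 2F; 3F; 4F; 5F; 6F; 7F)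
import Data.Fin.Properties as Fin
open import Data.Fin.Subset using (Subset; Nonempty; _∈_)
open import Data.Fin.Subset.Properties using (_∈?_)
open import Data.Integer.Base as ℤ using (ℤ; +_; -[1+_]; 0ℤ; 1ℤ)
import Data.Integer.Properties as ℤ
open import Data.List.Base as List using (allFin; cartesianProduct; filter)
open import Data.Maybe.Base using (Maybe; just; nothing; _>>=_)
open import Data.Nat.Base as ℕ using (ℕ; zero; suc; NonZero)
open import Data.Nat.Combinatorics using (_C_; nC1≡n; nCk+nC[k+1]≡[n+1]C[k+1])
import Data.Nat.Properties as ℕ
open import Data.Product.Base using (∃; _×_; _,_; proj₁; proj₂)
open import Data.Rational.Base as ℚ using (ℚ; 0ℚ)
import Data.Rational.Properties as ℚ
open import Data.Vec.Base as Vec using (Vec; lookup; tabulate; replicate; _[_]≔_)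
open import Data.Vec.Functional using (Vector)
open import Data.Vec.Properties using (lookup⇒[]=; []=⇒lookup; lookup∘tabulate)
open import Relation.Binary.Definitions using (tri<; tri≈; tri>)
open import Relation.Binary.PropositionalEquality
  using (_≡_; refl; sym; trans; cong; subst)
open import Relation.Nullary.Decidable
  using (Dec; yes; no; does; _×-dec_; dec-true)
open import Relation.Nullary.Negation using (contradiction)

------------------------------------------------------------------------
-- Clusterings and the Rand Index

-- The point x : Fin N stands for the element toℕ x + 1 of {1, …, N}.

label : ∀ {N} → Fin N → ℤ
label x = + suc (toℕ x)

-- A partition is presented as an enumeration of its blocks; by `nonempty`
-- and `disjoint` no block is listed twice.

record Clustering (N : ℕ) : Set where
  field
    size     : ℕ
    cluster  : Fin size → Subset N
    nonempty : ∀ k → Nonempty (cluster k)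
    disjoint : ∀ k l x → x ∈ cluster k → x ∈ cluster l → k ≡ l
    covers   : ∀ x → ∃ λ k → x ∈ cluster k

open Clustering public

SameCluster : ∀ {N} → Clustering N → Fin N → Fin N → Set
SameCluster P x y = ∃ λ k → x ∈ cluster P k × y ∈ cluster P k

sameCluster? : ∀ {N} (P : Clustering N) x y → Dec (SameCluster P x y)
sameCluster? P x y = Fin.any? λ k → x ∈? cluster P k ×-dec y ∈? cluster P k

I : ∀ {N} → Clustering N → Fin N → Fin N → ℕ
I P x y = if does (sameCluster? P x y) then 1 else 0

-- The number of pairs x < y on which both indicators take the value v.

agreements : ∀ {N} → ℕ → Clustering N → Clustering N → ℕ
agreements {N} v P₁ P₂ =
  List.length (filter
    (λ (x , y) → x Fin.<? y ×-dec I P₁ x y ℕ.≟ v ×-dec I P₂ x y ℕ.≟ v)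
    (cartesianProduct (allFin N) (allFin N)))

N₁₁ N₀₀ : ∀ {N} → Clustering N → Clustering N → ℕ
N₁₁ = agreements 1
N₀₀ = agreements 0

nC2-nonZero : ∀ {N} → 2 ℕ.≤ N → NonZero (N C 2)
nC2-nonZero {suc (suc n)} _ =
  subst NonZero
    (trans (cong (ℕ._+ suc n C 2) (sym (nC1≡n (suc n))))
           (nCk+nC[k+1]≡[n+1]C[k+1] (suc n) 1))
    _
nC2-nonZero {suc zero} (ℕ.s≤s ())

RandIndex : ∀ {N} → 2 ℕ.≤ N → Clustering N → Clustering N → ℚ
RandIndex {N} 2≤N P₁ P₂ = (+ (N₀₀ P₁ P₂ ℕ.+ N₁₁ P₁ P₂) ℚ./ (N C 2)) {{nC2-nonZero 2≤N}}

------------------------------------------------------------------------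
-- Change-point arrays

record IsChangePoints (N : ℕ) {r : ℕ} (A : Vector ℤ (suc r)) : Set where
  field
    increasing : ∀ {i j} → i Fin.< j → A i ℤ.< A j
    first      : A zero ≡ 0ℤ
    last       : A (fromℕ r) ≡ + N

-- {A[i] + 1, …, A[i+1]} ∩ {1, …, N}; for a change-point array the
-- intersection changes nothing, as 0 ≤ A[i] and A[i+1] ≤ N.

InBlock : ∀ {r} → Vector ℤ (suc r) → Fin r → ℤ → Set
InBlock A i y = ℤ.suc (A (inject₁ i)) ℤ.≤ y × y ℤ.≤ A (suc i)

inBlock? : ∀ {r} (A : Vector ℤ (suc r)) i y → Dec (InBlock A i y)
inBlock? A i y = ℤ.suc (A (inject₁ i)) ℤ.≤? y ×-dec y ℤ.≤? A (suc i)

block : ∀ {r} (N : ℕ) → Vector ℤ (suc r) → Fin r → Subset N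
block N A i = tabulate λ x → does (inBlock? A i (label x))

∈block⁺ : ∀ {r N} (A : Vector ℤ (suc r)) i {x : Fin N} →
          InBlock A i (label x) → x ∈ block N A i
∈block⁺ A i {x} p = lookup⇒[]= x _
  (trans (lookup∘tabulate _ x) (dec-true (inBlock? A i (label x)) p))

∈block⁻ : ∀ {r N} (A : Vector ℤ (suc r)) i {x : Fin N} →
          x ∈ block N A i → InBlock A i (label x)
∈block⁻ A i {x} x∈ = witness (inBlock? A i (label x))
  (trans (sym (lookup∘tabulate _ x)) ([]=⇒lookup x∈))
  where
  witness : ∀ {P : Set} (P? : Dec P) → does P? ≡ true → P
  witness (yes p) _ = p

label-surjective : ∀ {N} y → 0ℤ ℤ.< y → y ℤ.≤ + N → ∃ λ (x : Fin N) → label x ≡ y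
label-surjective (+ suc n)  _               (ℤ.+≤+ n<N) =
  fromℕ< n<N , cong (λ k → + suc k) (Fin.toℕ-fromℕ< n<N)
label-surjective (+ zero)   (ℤ.+<+ ()) _
label-surjective -[1+ n ]   ()         _

locate : ∀ {r} (A : Vector ℤ (suc r)) {y} →
         A zero ℤ.< y → y ℤ.≤ A (fromℕ r) → ∃ λ i → InBlock A i y
locate {zero}  A     lo hi = contradiction hi (ℤ.<⇒≱ lo)
locate {suc r} A {y} lo hi with y ℤ.≤? A (suc zero)
... | yes y≤ = zero , ℤ.i<j⇒suc[i]≤j lo , y≤
... | no  y≰ with locate (λ i → A (suc i)) (ℤ.≰⇒> y≰) hi
...   | i , p = suc i , p

module _ {N r : ℕ} {A : Vector ℤ (suc r)} (cp : IsChangePoints N A) where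

  open IsChangePoints cp

  private
    monotone : ∀ {i j} → i Fin.≤ j → A i ℤ.≤ A j
    monotone {i} {j} i≤j with i Fin.≟ j
    ... | yes refl = ℤ.≤-refl
    ... | no  i≢j  = ℤ.<⇒≤ (increasing (Fin.≤∧≢⇒< i≤j i≢j))

    ordered : ∀ {k l y} → k Fin.< l → y ℤ.≤ A (suc k) →
              A (inject₁ l) ℤ.< y → ∀ {B : Set} → B
    ordered {k} {l} k<l y≤ <y = contradiction
      (ℤ.≤-trans y≤ (monotone (subst (suc (toℕ k) ℕ.≤_) (sym (Fin.toℕ-inject₁ l)) k<l)))
      (ℤ.<⇒≱ <y)

    below : ∀ k {y} → InBlock A k y → A (inject₁ k) ℤ.< y
    below k (lo , _) = ℤ.suc[i]≤j⇒i<j lo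

    unique : ∀ k l {y} → InBlock A k y → InBlock A l y → k ≡ l
    unique k l p q with Fin.<-cmp k l
    ... | tri< k<l _ _ = ordered k<l (proj₂ p) (below l q)
    ... | tri≈ _ k≡l _ = k≡l
    ... | tri> _ _ l<k = ordered l<k (proj₂ q) (below k p)

    inhabited : ∀ k → Nonempty (block N A k)
    inhabited k with label-surjective (A (suc k))
                       (subst (ℤ._< A (suc k)) first (increasing (ℕ.s≤s ℕ.z≤n)))
                       (subst (A (suc k) ℤ.≤_) last (monotone (Fin.≤fromℕ (suc k))))
    ... | x , lx≡ = x , ∈block⁺ A k (subst (InBlock A k) (sym lx≡)
            ( ℤ.i<j⇒suc[i]≤j (increasing (ℕ.s≤s (ℕ.≤-reflexive (Fin.toℕ-inject₁ k))))
            , ℤ.≤-refl))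

    covered : ∀ (x : Fin N) → ∃ λ k → x ∈ block N A k
    covered x with locate A {label x}
                     (subst (ℤ._< label x) (sym first) (ℤ.+<+ (ℕ.s≤s ℕ.z≤n)))
                     (subst (label x ℤ.≤_) (sym last) (ℤ.+≤+ (Fin.toℕ<n x)))
    ... | k , p = k , ∈block⁺ A k p

  clustering : Clustering N
  clustering = record
    { size     = r
    ; cluster  = block N A
    ; nonempty = inhabited
    ; disjoint = λ k l x x∈k x∈l → unique k l (∈block⁻ A k x∈k) (∈block⁻ A l x∈l)
    ; covers   = covered
    }

------------------------------------------------------------------------
-- An imperative language with unit-cost time and peak-memory accounting

data Ty : Set where
  int rat : Ty

Val : Ty → Set
Val int = ℤ
Val rat = ℚ

data Op : Ty → Set where
  add sub mul min max : Op int
  subℚ divℚ           : Op rat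

applyOp : ∀ {τ} → Op τ → Val τ → Val τ → Maybe (Val τ)
applyOp add  x y = just (x ℤ.+ y)
applyOp sub  x y = just (x ℤ.- y)
applyOp mul  x y = just (x ℤ.* y)
applyOp min  x y = just (x ℤ.⊓ y)
applyOp max  x y = just (x ℤ.⊔ y)
applyOp subℚ x y = just (x ℚ.- y)
applyOp divℚ x y with y ℚ.≟ 0ℚ
... | yes _  = nothing
... | no y≢0 = just ((x ℚ.÷ y) {{ℚ.≢-nonZero y≢0}})

record Array : Set where
  constructor array
  field
    {length} : ℕ
    entries  : Vector ℤ length

readArray : Array → ℤ → Maybe ℤ
readArray (array {n} A) (+ i) with i ℕ.<? n
... | yes i<n = just (A (fromℕ< i<n))
... | no  _   = nothing
readArray _ -[1+ _ ] = nothing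

-- A program has a fixed finite set of integer variables, and read-only input
-- arrays. Out-of-range array accesses and divisions by 0 are errors (`nothing`).

module Language (vars arrays : ℕ) where

  infix  9 _[_]
  infixl 8 _⊗_ _⊘_
  infixl 7 _⊕_ _⊖_ _⊝_
  infix  6 _≔_
  infixr 5 _⨾_

  data Expr : Ty → Set where
    lit  : ℤ → Expr int
    var  : Fin vars → Expr int
    sizeOf : Fin arrays → Expr int
    _[_] : Fin arrays → Expr int → Expr int
    abs  : Expr int → Expr int
    ↑_   : Expr int → Expr rat
    bin  : ∀ {τ} → Op τ → Expr τ → Expr τ → Expr τ

  _⊕_ _⊖_ _⊗_ minₑ maxₑ : Expr int → Expr int → Expr int
  _⊕_  = bin add
  _⊖_  = bin sub
  _⊗_  = bin mul
  minₑ = bin min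
  maxₑ = bin max

  _⊝_ _⊘_ : Expr rat → Expr rat → Expr rat
  _⊝_ = bin subℚ
  _⊘_ = bin divℚ

  data Cmd : Set where
    _≔_               : Fin vars → Expr int → Cmd
    _⨾_               : Cmd → Cmd → Cmd
    if_<_then_else_   : Expr int → Expr int → Cmd → Cmd → Cmd
    -- for x = e₁, e₁ + 1, …, e₂, with e₁ and e₂ evaluated once, on entry
    for_from_to_loop_ : Fin vars → Expr int → Expr int → Cmd → Cmd
    break             : Cmd
    return            : Expr rat → Cmd

  -- The number of operations performed in evaluating an expression.

  cost : ∀ {τ} → Expr τ → ℕ
  cost (lit _)       = 0
  cost (var _)       = 0
  cost (sizeOf _)    = 1
  cost (_ [ e ])     = 1 ℕ.+ cost e
  cost (abs e)       = 1 ℕ.+ cost e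
  cost (↑ e)         = cost e
  cost (bin _ e₁ e₂) = 1 ℕ.+ cost e₁ ℕ.+ cost e₂

  -- The number of temporaries needed to evaluate one expression, respectively
  -- two expressions both of whose values are to be kept: the first value is
  -- held while the second expression is evaluated.

  temps  : ∀ {τ} → Expr τ → ℕ
  temps₂ : ∀ {τ} → Expr τ → Expr τ → ℕ

  temps (lit _)       = 1
  temps (var _)       = 1
  temps (sizeOf _)    = 1
  temps (_ [ e ])     = temps e
  temps (abs e)       = temps e
  temps (↑ e)         = temps e
  temps (bin _ e₁ e₂) = temps₂ e₁ e₂

  temps₂ e₁ e₂ = temps e₁ ℕ.⊔ suc (temps e₂)

  Store : Set
  Store = Vec ℤ vars

  data Signal : Set where
    normal broken : Signal
    returned      : ℚ → Signal

  -- `space` is the peak number of numbers stored besides the variables.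

  record Outcome : Set where
    constructor outcome
    field
      signal : Signal
      store  : Store
      time   : ℕ
      space  : ℕ

  record Output : Set where
    constructor output
    field
      value  : ℚ
      time   : ℕ
      memory : ℕ

  andThen : Outcome → (Store → Maybe Outcome) → Maybe Outcome
  andThen (outcome normal σ t m) k = do
    outcome g σ′ t′ m′ ← k σ
    just (outcome g σ′ (t ℕ.+ t′) (m ℕ.⊔ m′))
  andThen o _ = just o

  -- The loop with n values v, v + 1, … of x still to be processed. An iteration
  -- makes a comparison (is there a next value?) and an assignment (to x), runs
  -- the body and, unless the loop is left, increments the loop counter (an
  -- addition and an assignment). A last comparison ends an exhausted loop.

  iterate : (Store → Maybe Outcome) → Fin vars → ℕ → ℤ → Store → Maybe Outcome
  iterate body x zero    v σ = just (outcome normal σ 1 0)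
  iterate body x (suc n) v σ = body (σ [ x ]≔ v) >>= λ where
    (outcome normal σ′ t m) → do
      outcome g σ″ t′ m′ ← iterate body x n (ℤ.suc v) σ′
      just (outcome g σ″ (4 ℕ.+ t ℕ.+ t′) (m ℕ.⊔ m′))
    (outcome broken σ′ t m)       → just (outcome normal σ′ (2 ℕ.+ t) m)
    (outcome (returned q) σ′ t m) → just (outcome (returned q) σ′ (2 ℕ.+ t) m)

  module _ (inputs : Vec Array arrays) where

    eval : ∀ {τ} → Expr τ → Store → Maybe (Val τ)
    eval (lit z)        σ = just z
    eval (var x)        σ = just (lookup σ x)
    eval (sizeOf a)     σ = just (+ Array.length (lookup inputs a))
    eval (a [ e ])      σ = eval e σ >>= readArray (lookup inputs a)
    eval (abs e)        σ = do
      z ← eval e σ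
      just (+ ℤ.∣ z ∣)
    eval (↑ e)          σ = do
      z ← eval e σ
      just (z ℚ./ 1)
    eval (bin op e₁ e₂) σ = do
      x ← eval e₁ σ
      y ← eval e₂ σ
      applyOp op x y

    exec : Cmd → Store → Maybe Outcome
    exec (x ≔ e) σ = do
      z ← eval e σ
      just (outcome normal (σ [ x ]≔ z) (1 ℕ.+ cost e) (temps e))
    exec (c₁ ⨾ c₂) σ = do
      o ← exec c₁ σ
      andThen o (exec c₂)
    exec (if e₁ < e₂ then c₁ else c₂) σ = do
      x ← eval e₁ σ
      y ← eval e₂ σ
      outcome g σ′ t m ← if does (x ℤ.<? y) then exec c₁ σ else exec c₂ σ
      just (outcome g σ′ (1 ℕ.+ cost e₁ ℕ.+ cost e₂ ℕ.+ t) (temps₂ e₁ e₂ ℕ.⊔ m))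
    -- The loop counter and the upper bound occupy 2 cells while the loop runs,
    -- and are assigned on entry.
    exec (for x from e₁ to e₂ loop c) σ = do
      lo ← eval e₁ σ
      hi ← eval e₂ σ
      outcome g σ′ t m ← iterate (exec c) x ℤ.∣ 0ℤ ℤ.⊔ (ℤ.suc hi ℤ.- lo) ∣ lo σ
      just (outcome g σ′ (2 ℕ.+ cost e₁ ℕ.+ cost e₂ ℕ.+ t) (temps₂ e₁ e₂ ℕ.⊔ (2 ℕ.+ m)))
    exec break σ = just (outcome broken σ 0 0)
    exec (return e) σ = do
      q ← eval e σ
      just (outcome (returned q) σ (cost e) (temps e))

    -- The memory of a run includes all variables, but not the input arrays.

    run : Cmd → Maybe Output
    run c = exec c (replicate vars 0ℤ) >>= λ where
      (outcome (returned q) _ t m) → just (output q t (vars ℕ.+ m))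
      _                            → nothing

------------------------------------------------------------------------
-- The procedure RICPD

open Language 8 2 public using (Output; output)

module RICPD where

  open Language 8 2

  pattern r = 0F
  pattern s = 1F
  pattern d = 2F
  pattern b = 3F
  pattern i = 4F
  pattern j = 5F
  pattern m = 6F
  pattern N = 7F

  pattern C₁ = 0F
  pattern C₂ = 1F

  one = lit 1ℤ

  i+1 j+1 : Expr int
  i+1 = var i ⊕ one
  j+1 = var j ⊕ one

  -- N(N-1)/2, computed with elementary operations
  binom : Expr rat
  binom = (↑ (var N ⊗ (var N ⊖ one))) ⊘ (↑ lit (+ 2))

  program : Cmd
  program =
    r ≔ sizeOf C₁ ⊖ one ⨾
    s ≔ sizeOf C₂ ⊖ one ⨾
    d ≔ lit 0ℤ ⨾
    b ≔ lit 0ℤ ⨾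
    (for i from lit 0ℤ to var r ⊖ one loop
      for j from var b to var s ⊖ one loop
        ( m ≔ minₑ (C₁ [ i+1 ]) (C₂ [ j+1 ]) ⊖ maxₑ (C₁ [ var i ]) (C₂ [ var j ]) ⨾
          m ≔ maxₑ (lit 0ℤ) (var m) ⨾
          d ≔ var d ⊕ var m ⊗ abs (C₁ [ i+1 ] ⊖ C₂ [ j+1 ]) ⨾
          (if C₁ [ i+1 ] < C₂ [ j+1 ]
            then break
            else (b ≔ j+1)))) ⨾
    N ≔ C₁ [ var r ] ⨾
    return ((↑ one) ⊝ (↑ var d) ⊘ binom)

runRICPD : ∀ {r s} → Vector ℤ (suc r) → Vector ℤ (suc s) → Maybe Output
runRICPD A₁ A₂ = Language.run 8 2 (array A₁ Vec.∷ array A₂ Vec.∷ Vec.[]) RICPD.program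

module Submission where

-- Write eₖ(x) for the last element of the block of x in the k-th clustering.
-- For x < y, the points x and y share a block iff y ≤ eₖ(x), so the clusterings
-- disagree on exactly |e₁(x) − e₂(x)| of the pairs (x , y). This number is
-- |C₁[i+1] − C₂[j+1]| on the overlap of block i of the first clustering with
-- block j of the second, and the procedure sweeps the overlaps from left to
-- right: when it visits (i , j), b = j and d is the number of disagreeing pairs
-- whose smaller point is at most max(C₁[i], C₂[j]). Each inner iteration either
-- advances j or ends the row, which gives the time bound.

open import Defs
import Algebra.Properties.Semiring.Sum as SemiringSum
open import Data.Bool.Base as Bool using (true; false)
open import Data.Fin.Base as Fin using (Fin; zero; suc; toℕ; fromℕ; fromℕ<; inject₁)
open import Data.Fin.Patterns using (0F; 1F)
import Data.Fin.Properties as Fin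
open import Data.Fin.Subset using (_∈_)
open import Data.Integer.Base as ℤ using (ℤ; +_; 0ℤ; 1ℤ)
import Data.Integer.Properties as ℤ
import Data.Integer.Tactic.RingSolver as ℤ-Solver
open import Data.List.Base as List using (_++_; length; cartesianProduct; filter; tabulate)
import Data.List.Properties as List
open import Data.Maybe.Base using (just; maybe′; _>>=_)
open import Data.Nat.Base as ℕ
  using (ℕ; zero; suc; z≤n; s≤s; _+_; _*_; _∸_; _≤_; _<_; _⊔_; _⊓_; ∣_-_∣)
open import Data.Nat.Combinatorics using (_C_; nC1≡n; nCk+nC[k+1]≡[n+1]C[k+1])
open import Data.Nat.Properties as ℕ using (_<?_)
open import Data.Nat.Tactic.RingSolver using (solve-∀)
open import Data.Product.Base using (∃-syntax; _×_; _,_; proj₁; proj₂)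
open import Data.Rational.Base as ℚ using (0ℚ; fromℚᵘ; toℚᵘ)
import Data.Rational.Properties as ℚ
open import Data.Rational.Unnormalised.Base as ℚᵘ using (mkℚᵘ; *≡*)
import Data.Rational.Unnormalised.Properties as ℚᵘ
open import Data.Sum.Base using (inj₁; inj₂)
open import Data.Vec.Base using (Vec; []; _∷_; lookup; replicate; _[_]≔_)
open import Data.Vec.Functional using (Vector)
open import Function.Base using (_∘_; _$_)
open import Function.Bundles using (mk⇔)
open import Relation.Binary.PropositionalEquality
  using (_≡_; _≢_; refl; sym; trans; cong; cong₂; subst; module ≡-Reasoning)
open import Relation.Nullary.Decidable
  using (Dec; yes; no; does; does-⇔; ¬?; _×-dec_; dec-true; dec-false)
open import Relation.Nullary.Negation using (contradiction)
open import Relation.Unary using (Decidable)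

-- Indicator sums and counting

open SemiringSum ℕ.+-*-semiring
  using (sum; sum-syntax; sum-cong-≗; sum-replicate-zero; ∑-distrib-+; *-distribʳ-sum)

infix 8 ⟦_⟧

⟦_⟧ : ∀ {p} {P : Set p} → Dec P → ℕ
⟦ P? ⟧ = Bool.if does P? then 1 else 0

⟦⟧-cong : ∀ {p q} {P : Set p} {Q : Set q} → (P → Q) → (Q → P) →
          (P? : Dec P) (Q? : Dec Q) → ⟦ P? ⟧ ≡ ⟦ Q? ⟧
⟦⟧-cong P⇒Q Q⇒P P? Q? = cong (Bool.if_then 1 else 0) (does-⇔ (mk⇔ P⇒Q Q⇒P) P? Q?)

length-filter-tabulate : ∀ {a p} {A : Set a} {P : A → Set p} (P? : Decidable P) {n} (f : Fin n → A) →
  length (filter P? (tabulate f)) ≡ ∑[ k < n ] ⟦ P? (f k) ⟧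
length-filter-tabulate P? {zero}  f = refl
length-filter-tabulate P? {suc n} f with does (P? (f zero))
... | true  = cong suc (length-filter-tabulate P? (f ∘ suc))
... | false = length-filter-tabulate P? (f ∘ suc)

length-filter-cartesianProduct :
  ∀ {a b p} {A : Set a} {B : Set b} {P : A × B → Set p} (P? : Decidable P)
  {m n} (f : Fin m → A) (g : Fin n → B) →
  length (filter P? (cartesianProduct (tabulate f) (tabulate g)))
    ≡ ∑[ k < m ] ∑[ l < n ] ⟦ P? (f k , g l) ⟧
length-filter-cartesianProduct P? {zero}  f g = refl
length-filter-cartesianProduct P? {suc m} f g = begin
  length (filter P? (row ++ rest))
    ≡⟨ cong length (List.filter-++ P? row rest) ⟩
  length (filter P? row ++ filter P? rest)
    ≡⟨ List.length-++ (filter P? row) ⟩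
  length (filter P? row) + length (filter P? rest)
    ≡⟨ cong₂ _+_ (cong (length ∘ filter P?) (List.map-tabulate g (f zero ,_)))
                 (length-filter-cartesianProduct P? (f ∘ suc) g) ⟩
  length (filter P? (tabulate λ l → f zero , g l)) + ∑[ k < m ] ∑[ l < _ ] ⟦ P? (f (suc k) , g l) ⟧
    ≡⟨ cong (_+ _) (length-filter-tabulate P? (λ l → f zero , g l)) ⟩
  ∑[ k < suc m ] ∑[ l < _ ] ⟦ P? (f k , g l) ⟧ ∎
  where
  open ≡-Reasoning
  row  = List.map (f zero ,_) (tabulate g)
  rest = cartesianProduct (tabulate (f ∘ suc)) (tabulate g)

length-filter-pairs : ∀ {n p} {P : Fin n × Fin n → Set p} (P? : Decidable P) →
  length (filter P? (cartesianProduct (List.allFin n) (List.allFin n)))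
    ≡ ∑[ x < n ] ∑[ y < n ] ⟦ P? (x , y) ⟧
length-filter-pairs P? = length-filter-cartesianProduct P? (λ x → x) (λ y → y)

∑-cong-+ : ∀ {n} (f g h : Fin n → ℕ) → (∀ k → f k + g k ≡ h k) → sum f + sum g ≡ sum h
∑-cong-+ f g h eq = trans (sym (∑-distrib-+ f g)) (sum-cong-≗ eq)

-- The lower bound is a negated <, not a ≤, because the indicator then reduces
-- definitionally when k, a and b are all successors.

infix 8 _∈[_,_⟩?

_∈[_,_⟩? : ∀ k a b → Dec _
k ∈[ a , b ⟩? = ¬? (k <? a) ×-dec k <? b

-- No `a ≤ b` is assumed: for `b < a` both sides are 0. An absolute difference can thus be counted
-- as two intervals, at least one of them empty.
∑-interval : ∀ n a b → b ≤ n → ∑[ k < n ] ⟦ toℕ k ∈[ a , b ⟩? ⟧ ≡ b ∸ a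
∑-interval zero    a       zero    _         = sym (ℕ.0∸n≡0 a)
∑-interval (suc n) zero    zero    _         = ∑-interval n zero zero z≤n
∑-interval (suc n) (suc a) zero    _         = trans (∑-interval n a zero z≤n) (ℕ.0∸n≡0 a)
∑-interval (suc n) zero    (suc b) (s≤s b≤n) = cong suc (∑-interval n zero b b≤n)
∑-interval (suc n) (suc a) (suc b) (s≤s b≤n) = ∑-interval n a b b≤n

-- Pairs are grouped by their smaller point: `k` has `n ∸ suc (toℕ k)` larger partners. In Pascal's
-- rule the term `n C 1` is the group of the point 0.
nC2≡∑ : ∀ n → n C 2 ≡ ∑[ k < n ] (n ∸ suc (toℕ k))
nC2≡∑ zero    = refl
nC2≡∑ (suc n) = begin
  suc n C 2                             ≡⟨ nCk+nC[k+1]≡[n+1]C[k+1] n 1 ⟨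
  n C 1 + n C 2                         ≡⟨ cong₂ _+_ (nC1≡n n) (nC2≡∑ n) ⟩
  n + ∑[ k < n ] (n ∸ suc (toℕ k))      ∎
  where open ≡-Reasoning

-- Doubled to stay in ℕ; this identifies the value of the program's `binom`, which halves a product.
nC2*2≡n*[n∸1] : ∀ n → (n C 2) * 2 ≡ n * (n ∸ 1)
nC2*2≡n*[n∸1] zero          = refl
nC2*2≡n*[n∸1] (suc zero)    = refl
nC2*2≡n*[n∸1] (suc (suc n)) = begin
  (suc (suc n) C 2) * 2                 ≡⟨ cong (_* 2) (nCk+nC[k+1]≡[n+1]C[k+1] (suc n) 1) ⟨
  (suc n C 1 + suc n C 2) * 2           ≡⟨ cong (λ m → (m + suc n C 2) * 2) (nC1≡n (suc n)) ⟩
  (suc n + suc n C 2) * 2               ≡⟨ ℕ.*-distribʳ-+ 2 (suc n) (suc n C 2) ⟩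
  suc n * 2 + (suc n C 2) * 2           ≡⟨ cong (λ m → suc n * 2 + m) (nC2*2≡n*[n∸1] (suc n)) ⟩
  suc n * 2 + suc n * n                 ≡⟨ solve n ⟩
  suc (suc n) * suc n                   ∎
  where
  open ≡-Reasoning
  solve : ∀ n → suc n * 2 + suc n * n ≡ suc (suc n) * suc n
  solve = solve-∀

∣m-n∣≡[m∸n]+[n∸m] : ∀ m n → ∣ m - n ∣ ≡ (m ∸ n) + (n ∸ m)
∣m-n∣≡[m∸n]+[n∸m] zero    n       = sym (cong (λ m → m + n) (ℕ.0∸n≡0 n))
∣m-n∣≡[m∸n]+[n∸m] (suc m) zero    = sym (ℕ.+-identityʳ (suc m))
∣m-n∣≡[m∸n]+[n∸m] (suc m) (suc n) = ∣m-n∣≡[m∸n]+[n∸m] m n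

-- Change-point arrays and block ends

readArray-toℕ : ∀ {n} (A : Vector ℤ n) k → readArray (array A) (+ toℕ k) ≡ just (A k)
readArray-toℕ {n} A k with toℕ k <? n
... | yes k<n = cong (just ∘ A) (Fin.fromℕ<-toℕ k k<n)
... | no  k≮n = contradiction (Fin.toℕ<n k) k≮n

abstract
  -- Positions past the end of the array have the junk value 0. Unfolding is
  -- blocked so that Agda can infer positions from equations between boundaries.
  boundary : ∀ {r} → Vector ℤ (suc r) → ℕ → ℕ
  boundary A k = maybe′ ℤ.∣_∣ 0 (readArray (array A) (+ k))

  boundary-toℕ : ∀ {r} (A : Vector ℤ (suc r)) k → boundary A (toℕ k) ≡ ℤ.∣ A k ∣
  boundary-toℕ A k = cong (maybe′ ℤ.∣_∣ 0) (readArray-toℕ A k)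

module ChangePoints {N r : ℕ} {A : Vector ℤ (suc r)} (cp : IsChangePoints N A) where

  open IsChangePoints cp

  private
    c : ℕ → ℕ
    c = boundary A

  nonNegative : ∀ k → 0ℤ ℤ.≤ A k
  nonNegative zero    = ℤ.≤-reflexive (sym first)
  nonNegative (suc k) = ℤ.<⇒≤ (subst (ℤ._< A (suc k)) first (increasing (s≤s z≤n)))

  +boundary : ∀ k → + boundary A (toℕ k) ≡ A k
  +boundary k = trans (cong +_ (boundary-toℕ A k)) (ℤ.0≤i⇒+∣i∣≡i (nonNegative k))

  reads : ∀ {k} → k ≤ r → readArray (array A) (+ k) ≡ just (+ boundary A k)
  reads {k} k≤r = subst (λ k → readArray (array A) (+ k) ≡ just (+ boundary A k))
    (Fin.toℕ-fromℕ< (s≤s k≤r))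
    (trans (readArray-toℕ A _) (cong just (sym (+boundary (fromℕ< (s≤s k≤r))))))

  boundary-zero : boundary A 0 ≡ 0
  boundary-zero = ℤ.+-injective (trans (+boundary zero) first)

  boundary-last : boundary A r ≡ N
  boundary-last = ℤ.+-injective $ begin
    + boundary A r                   ≡⟨ cong (+_ ∘ boundary A) (Fin.toℕ-fromℕ r) ⟨
    + boundary A (toℕ (fromℕ r))     ≡⟨ +boundary (fromℕ r) ⟩
    A (fromℕ r)                      ≡⟨ last ⟩
    + N                              ∎
    where open ≡-Reasoning

  boundary-< : ∀ {k} → k < r → c k < c (suc k)
  boundary-< {k} k<r = ℤ.drop‿+<+ $ begin-strict
    + c k                          ≡⟨ cong (+_ ∘ c) toℕ-κ ⟨
    + c (toℕ (inject₁ κ))          ≡⟨ +boundary (inject₁ κ) ⟩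
    A (inject₁ κ)                  <⟨ increasing (s≤s (ℕ.≤-reflexive (Fin.toℕ-inject₁ κ))) ⟩
    A (suc κ)                      ≡⟨ +boundary (suc κ) ⟨
    + c (toℕ (suc κ))              ≡⟨ cong (+_ ∘ c ∘ suc) (Fin.toℕ-fromℕ< k<r) ⟩
    + c (suc k)                    ∎
    where
    open ℤ.≤-Reasoning
    κ = fromℕ< k<r
    toℕ-κ : toℕ (inject₁ κ) ≡ k
    toℕ-κ = trans (Fin.toℕ-inject₁ κ) (Fin.toℕ-fromℕ< k<r)

  boundary-≤ : ∀ {k} → k < r → c k ≤ c (suc k)
  boundary-≤ = ℕ.<⇒≤ ∘ boundary-<

  -- Induction on `t`, the number of steps from `k` up to the last boundary, which is `N`.
  boundary≤N′ : ∀ t {k} → k + t ≡ r → c k ≤ N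
  boundary≤N′ zero    {k} eq = ℕ.≤-reflexive
    (trans (cong c (trans (sym (ℕ.+-identityʳ k)) eq)) boundary-last)
  boundary≤N′ (suc t) {k} eq = ℕ.≤-trans
    (boundary-≤ (subst (k <_) eq (ℕ.m<m+n k (s≤s z≤n))))
    (boundary≤N′ t (trans (sym (ℕ.+-suc k t)) eq))

  boundary≤N : ∀ {k} → k ≤ r → c k ≤ N
  boundary≤N {k} k≤r = boundary≤N′ (r ∸ k) (ℕ.m+[n∸m]≡n k≤r)

  private
    P = clustering cp

  blockOf : Fin N → Fin r
  blockOf x = proj₁ (covers P x)

  -- x stands for the element toℕ x + 1, hence A[k] + 1 ≤ toℕ x + 1 ≤ A[k+1]
  -- becomes A[k] ≤ toℕ x < A[k+1].

  ∈block⇒bounds : ∀ {k : Fin r} {x : Fin N} → x ∈ cluster P k →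
                  c (toℕ k) ≤ toℕ x × toℕ x < c (suc (toℕ k))
  ∈block⇒bounds {k} {x} x∈ with ∈block⁻ A k x∈
  ... | lo , hi =
    ℕ.s≤s⁻¹ (ℤ.drop‿+≤+ (subst (ℤ._≤ label x) (cong ℤ.suc eq) lo)) ,
    ℤ.drop‿+≤+ (subst (label x ℤ.≤_) (sym (+boundary (suc k))) hi)
    where
    eq : A (inject₁ k) ≡ + c (toℕ k)
    eq = trans (sym (+boundary (inject₁ k))) (cong (+_ ∘ c) (Fin.toℕ-inject₁ k))

  bounds⇒∈block : ∀ {k : Fin r} {x : Fin N} →
                  c (toℕ k) ≤ toℕ x → toℕ x < c (suc (toℕ k)) → x ∈ cluster P k
  bounds⇒∈block {k} {x} lo hi = ∈block⁺ A k
    ( subst (ℤ._≤ label x) (cong ℤ.suc eq) (ℤ.+≤+ (s≤s lo))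
    , subst (label x ℤ.≤_) (+boundary (suc k)) (ℤ.+≤+ hi))
    where
    eq : + c (toℕ k) ≡ A (inject₁ k)
    eq = trans (cong (+_ ∘ c) (sym (Fin.toℕ-inject₁ k))) (+boundary (inject₁ k))

  -- Points count from 0, so this is one past the last point of the block of `x`; it is also the
  -- label of that last point.
  blockEnd : Fin N → ℕ
  blockEnd x = c (suc (toℕ (blockOf x)))

  <blockEnd : ∀ x → toℕ x < blockEnd x
  <blockEnd x = proj₂ (∈block⇒bounds (proj₂ (covers P x)))

  blockEnd≤N : ∀ x → blockEnd x ≤ N
  blockEnd≤N x = boundary≤N (Fin.toℕ<n (blockOf x))

  -- The bounds put `x` in block `k`, so by disjointness `blockOf x` is that block.
  blockEnd-unique : ∀ (x : Fin N) {k} → k < r →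
                    c k ≤ toℕ x → toℕ x < c (suc k) → blockEnd x ≡ c (suc k)
  blockEnd-unique x {k} k<r lo hi = trans
    (cong (c ∘ suc ∘ toℕ) (disjoint P _ κ x (proj₂ (covers P x)) (bounds⇒∈block
      (subst (λ l → c l ≤ toℕ x) (sym toℕ-κ) lo)
      (subst (λ l → toℕ x < c (suc l)) (sym toℕ-κ) hi))))
    (cong (c ∘ suc) toℕ-κ)
    where
    κ = fromℕ< k<r
    toℕ-κ : toℕ κ ≡ k
    toℕ-κ = Fin.toℕ-fromℕ< k<r

  -- As `y` comes after `x`, it lies past the start of the block of `x`; only the end of that block
  -- can separate them.
  I≡⟦<blockEnd⟧ : ∀ {x y} → x Fin.< y → I P x y ≡ ⟦ toℕ y <? blockEnd x ⟧
  I≡⟦<blockEnd⟧ {x} {y} x<y = ⟦⟧-cong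
    (λ (k , x∈ , y∈) → subst (λ l → toℕ y < c (suc (toℕ l)))
      (disjoint P k (blockOf x) x x∈ (proj₂ (covers P x)))
      (proj₂ (∈block⇒bounds y∈)))
    (λ y< → blockOf x , proj₂ (covers P x) , bounds⇒∈block
      (ℕ.≤-trans (proj₁ (∈block⇒bounds (proj₂ (covers P x)))) (ℕ.<⇒≤ x<y)) y<)
    (sameCluster? P x y) (toℕ y <? blockEnd x)

-- Counting agreeing and disagreeing pairs

-- The decisions are arguments so that matching on them decides the identity.
agreement-count : ∀ {N x y e₁ e₂} → y < N → x < e₁ → x < e₂ →
  (x<y? : Dec (x < y)) (y≤x? : Dec (y < suc x)) (y<N? : Dec (y < N))
  (y<e₁? : Dec (y < e₁)) (y<e₂? : Dec (y < e₂)) →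
  ⟦ x<y? ×-dec ⟦ y<e₁? ⟧ ℕ.≟ 0 ×-dec ⟦ y<e₂? ⟧ ℕ.≟ 0 ⟧
    + ⟦ x<y? ×-dec ⟦ y<e₁? ⟧ ℕ.≟ 1 ×-dec ⟦ y<e₂? ⟧ ℕ.≟ 1 ⟧
    + (⟦ ¬? y<e₂? ×-dec y<e₁? ⟧ + ⟦ ¬? y<e₁? ×-dec y<e₂? ⟧)
  ≡ ⟦ ¬? y≤x? ×-dec y<N? ⟧
agreement-count y<N _ _ _ _ (no y≮N) _ _ = contradiction y<N y≮N
agreement-count _ _ _ (yes x<y) (yes y≤x) _ _ _ = contradiction x<y (ℕ.≤⇒≯ (ℕ.s≤s⁻¹ y≤x))
agreement-count _ _ _ (no x≮y) (no y≰x) _ _ _ = contradiction (s≤s (ℕ.≮⇒≥ x≮y)) y≰x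
agreement-count _ _ _ (yes _) (no _) (yes _) (yes _) (yes _) = refl
agreement-count _ _ _ (yes _) (no _) (yes _) (yes _) (no _)  = refl
agreement-count _ _ _ (yes _) (no _) (yes _) (no _)  (yes _) = refl
agreement-count _ _ _ (yes _) (no _) (yes _) (no _)  (no _)  = refl
agreement-count _ _ _ (no _) (yes _) (yes _) (yes _) (yes _) = refl
agreement-count _ x<e₁ _ (no x≮y) _ _ (no y≮e₁) _ = contradiction (ℕ.≤-<-trans (ℕ.≮⇒≥ x≮y) x<e₁) y≮e₁
agreement-count _ _ x<e₂ (no x≮y) _ _ _ (no y≮e₂) = contradiction (ℕ.≤-<-trans (ℕ.≮⇒≥ x≮y) x<e₂) y≮e₂

module Agreement {N r s : ℕ} {A₁ : Vector ℤ (suc r)} {A₂ : Vector ℤ (suc s)}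
                 (cp₁ : IsChangePoints N A₁) (cp₂ : IsChangePoints N A₂) where

  private
    module E₁ = ChangePoints cp₁
    module E₂ = ChangePoints cp₂
    P₁ = clustering cp₁
    P₂ = clustering cp₂

  distance : Fin N → ℕ
  distance x = ∣ E₁.blockEnd x - E₂.blockEnd x ∣

  -- The predicate filtered in `agreements`, so that `length-filter-pairs` applies to `N₀₀` and
  -- `N₁₁` by unfolding.
  agrees? : ∀ v (p : Fin N × Fin N) → Dec _
  agrees? v (x , y) = x Fin.<? y ×-dec I P₁ x y ℕ.≟ v ×-dec I P₂ x y ℕ.≟ v

  agrees-by-ends : ∀ v x y → ⟦ agrees? v (x , y) ⟧ ≡
    ⟦ x Fin.<? y ×-dec ⟦ toℕ y <? E₁.blockEnd x ⟧ ℕ.≟ v ×-dec ⟦ toℕ y <? E₂.blockEnd x ⟧ ℕ.≟ v ⟧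
  agrees-by-ends v x y = ⟦⟧-cong
    (λ (x<y , eq₁ , eq₂) → x<y , trans (sym (E₁.I≡⟦<blockEnd⟧ x<y)) eq₁ , trans (sym (E₂.I≡⟦<blockEnd⟧ x<y)) eq₂)
    (λ (x<y , eq₁ , eq₂) → x<y , trans (E₁.I≡⟦<blockEnd⟧ x<y) eq₁ , trans (E₂.I≡⟦<blockEnd⟧ x<y) eq₂)
    (agrees? v (x , y))
    (x Fin.<? y ×-dec ⟦ toℕ y <? E₁.blockEnd x ⟧ ℕ.≟ v ×-dec ⟦ toℕ y <? E₂.blockEnd x ⟧ ℕ.≟ v)

  -- Each `y` after `x` is counted once: before both ends the clusterings agree on 1, at or past
  -- both they agree on 0, and between the ends they disagree. No other `y` is counted, since both
  -- ends lie beyond `x`.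
  agreements+distance : ∀ x →
    ∑[ y < N ] ⟦ agrees? 0 (x , y) ⟧ + ∑[ y < N ] ⟦ agrees? 1 (x , y) ⟧ + distance x
      ≡ N ∸ suc (toℕ x)
  agreements+distance x = begin
    ∑[ y < N ] a₀ y + ∑[ y < N ] a₁ y + ∣ e₁ - e₂ ∣
      ≡⟨ cong₂ _+_ (sym (∑-distrib-+ a₀ a₁)) (∣m-n∣≡[m∸n]+[n∸m] e₁ e₂) ⟩
    ∑[ y < N ] (a₀ y + a₁ y) + ((e₁ ∸ e₂) + (e₂ ∸ e₁))
      ≡⟨ cong (λ n → ∑[ y < N ] (a₀ y + a₁ y) + n)
           (cong₂ _+_ (∑-interval N e₂ e₁ (E₁.blockEnd≤N x)) (∑-interval N e₁ e₂ (E₂.blockEnd≤N x))) ⟨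
    ∑[ y < N ] (a₀ y + a₁ y) + (∑[ y < N ] d₁ y + ∑[ y < N ] d₂ y)
      ≡⟨ cong (λ n → ∑[ y < N ] (a₀ y + a₁ y) + n) (∑-distrib-+ d₁ d₂) ⟨
    ∑[ y < N ] (a₀ y + a₁ y) + ∑[ y < N ] (d₁ y + d₂ y)
      ≡⟨ ∑-cong-+ (λ y → a₀ y + a₁ y) (λ y → d₁ y + d₂ y) _ pointwise ⟩
    ∑[ y < N ] ⟦ toℕ y ∈[ suc (toℕ x) , N ⟩? ⟧
      ≡⟨ ∑-interval N (suc (toℕ x)) N ℕ.≤-refl ⟩
    N ∸ suc (toℕ x) ∎
    where
    open ≡-Reasoning
    e₁ = E₁.blockEnd x
    e₂ = E₂.blockEnd x
    a₀ a₁ d₁ d₂ : Fin N → ℕ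
    a₀ y = ⟦ agrees? 0 (x , y) ⟧
    a₁ y = ⟦ agrees? 1 (x , y) ⟧
    d₁ y = ⟦ toℕ y ∈[ e₂ , e₁ ⟩? ⟧
    d₂ y = ⟦ toℕ y ∈[ e₁ , e₂ ⟩? ⟧
    pointwise : ∀ y → a₀ y + a₁ y + (d₁ y + d₂ y) ≡ ⟦ toℕ y ∈[ suc (toℕ x) , N ⟩? ⟧
    pointwise y = trans
      (cong (_+ (d₁ y + d₂ y)) (cong₂ _+_ (agrees-by-ends 0 x y) (agrees-by-ends 1 x y)))
      (agreement-count (Fin.toℕ<n y) (E₁.<blockEnd x) (E₂.<blockEnd x)
        (x Fin.<? y) (toℕ y <? suc (toℕ x)) (toℕ y <? N) (toℕ y <? e₁) (toℕ y <? e₂))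

  N₀₀+N₁₁+∑distance : N₀₀ P₁ P₂ + N₁₁ P₁ P₂ + ∑[ x < N ] distance x ≡ N C 2
  N₀₀+N₁₁+∑distance = begin
    N₀₀ P₁ P₂ + N₁₁ P₁ P₂ + ∑[ x < N ] distance x
      ≡⟨ cong (_+ ∑[ x < N ] distance x)
           (cong₂ _+_ (length-filter-pairs (agrees? 0)) (length-filter-pairs (agrees? 1))) ⟩
    ∑[ x < N ] n₀ x + ∑[ x < N ] n₁ x + ∑[ x < N ] distance x
      ≡⟨ cong (_+ ∑[ x < N ] distance x) (∑-distrib-+ n₀ n₁) ⟨
    ∑[ x < N ] (n₀ x + n₁ x) + ∑[ x < N ] distance x
      ≡⟨ ∑-cong-+ (λ x → n₀ x + n₁ x) distance _ agreements+distance ⟩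
    ∑[ x < N ] (N ∸ suc (toℕ x))
      ≡⟨ nC2≡∑ N ⟨
    N C 2 ∎
    where
    open ≡-Reasoning
    n₀ n₁ : Fin N → ℕ
    n₀ x = ∑[ y < N ] ⟦ agrees? 0 (x , y) ⟧
    n₁ x = ∑[ y < N ] ⟦ agrees? 1 (x , y) ⟧

  -- The disagreeing pairs whose smaller point is at least `p`: what a sweep that has reached `p`
  -- has yet to count. Adding it to `d` gives a loop invariant free of subtraction.
  remaining : ℕ → ℕ
  remaining p = ∑[ x < N ] (⟦ ¬? (toℕ x <? p) ⟧ * distance x)

  remaining-zero : remaining 0 ≡ ∑[ x < N ] distance x
  remaining-zero = sum-cong-≗ (λ x → ℕ.*-identityˡ (distance x))

  remaining-N : remaining N ≡ 0
  remaining-N = trans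
    (sum-cong-≗ λ x → cong (λ b → (Bool.if b then 1 else 0) * distance x)
      (dec-false (¬? (toℕ x <? N)) (λ x≮N → x≮N (Fin.toℕ<n x))))
    (sum-replicate-zero N)

  -- The points from `p` on split at `q`, and each point of the first part contributes `K`.
  remaining-step : ∀ {p q K} → p ≤ q → q ≤ N → (∀ x → p ≤ toℕ x → toℕ x < q → distance x ≡ K) →
    remaining p ≡ (q ∸ p) * K + remaining q
  remaining-step {p} {q} {K} p≤q q≤N const = sym $ begin
    (q ∸ p) * K + remaining q
      ≡⟨ cong (λ m → m * K + remaining q) (∑-interval N p q q≤N) ⟨
    (∑[ x < N ] ⟦ toℕ x ∈[ p , q ⟩? ⟧) * K + remaining q
      ≡⟨ cong (_+ remaining q) (*-distribʳ-sum K (λ (x : Fin N) → ⟦ toℕ x ∈[ p , q ⟩? ⟧)) ⟩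
    ∑[ x < N ] (⟦ toℕ x ∈[ p , q ⟩? ⟧ * K) + remaining q
      ≡⟨ ∑-cong-+ _ _ _ (λ x → split x (toℕ x <? p) (toℕ x <? q)) ⟩
    remaining p ∎
    where
    open ≡-Reasoning
    split : ∀ x (x<p? : Dec (toℕ x < p)) (x<q? : Dec (toℕ x < q)) →
      ⟦ ¬? x<p? ×-dec x<q? ⟧ * K + ⟦ ¬? x<q? ⟧ * distance x ≡ ⟦ ¬? x<p? ⟧ * distance x
    split x (yes _)   (yes _)   = refl
    split x (yes x<p) (no x≮q)  = contradiction (ℕ.<-≤-trans x<p p≤q) x≮q
    split x (no x≮p)  (yes x<q) = trans (ℕ.+-identityʳ _)
      (cong (1 *_) (sym (const x (ℕ.≮⇒≥ x≮p) x<q)))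
    split x (no _)    (no _)    = refl

  -- On the overlap of the two blocks both block ends are fixed, so the distance is constant. The
  -- hypotheses `a ≤ b′` and `b ≤ a′` ensure that the overlap does not start after it ends.
  remaining-block : ∀ {k l} → k < r → l < s →
    let a = boundary A₁ k ; a′ = boundary A₁ (suc k)
        b = boundary A₂ l ; b′ = boundary A₂ (suc l) in
    a ≤ b′ → b ≤ a′ →
    remaining (a ⊔ b) ≡ ((a′ ⊓ b′) ∸ (a ⊔ b)) * ∣ a′ - b′ ∣ + remaining (a′ ⊓ b′)
  remaining-block k<r l<s a≤b′ b≤a′ = remaining-step
    (ℕ.⊔-lub (ℕ.⊓-glb (E₁.boundary-≤ k<r) a≤b′) (ℕ.⊓-glb b≤a′ (E₂.boundary-≤ l<s)))
    (ℕ.≤-trans (ℕ.m⊓n≤m _ _) (E₁.boundary≤N k<r))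
    (λ x lo hi → cong₂ ∣_-_∣
      (E₁.blockEnd-unique x k<r (ℕ.m⊔n≤o⇒m≤o _ _ lo) (ℕ.m<n⊓o⇒m<n _ _ hi))
      (E₂.blockEnd-unique x l<s (ℕ.m⊔n≤o⇒n≤o _ _ lo) (ℕ.m<n⊓o⇒m<o _ _ hi)))

-- Rational division

-- For positive `n`, `i ℚ./ n` is `fromℚᵘ` of an unreduced fraction. Moving the operations under
-- `fromℚᵘ` reduces identities between quotients to integer ones, which the ring solver settles.
fromℚᵘ-homo-* : ∀ u v → fromℚᵘ u ℚ.* fromℚᵘ v ≡ fromℚᵘ (u ℚᵘ.* v)
fromℚᵘ-homo-* u v = ℚ.toℚᵘ-injective $ begin
  toℚᵘ (fromℚᵘ u ℚ.* fromℚᵘ v)          ≈⟨ ℚ.toℚᵘ-homo-* (fromℚᵘ u) (fromℚᵘ v) ⟩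
  toℚᵘ (fromℚᵘ u) ℚᵘ.* toℚᵘ (fromℚᵘ v)  ≈⟨ ℚᵘ.*-cong (ℚ.toℚᵘ-fromℚᵘ u) (ℚ.toℚᵘ-fromℚᵘ v) ⟩
  u ℚᵘ.* v                              ≈⟨ ℚ.toℚᵘ-fromℚᵘ (u ℚᵘ.* v) ⟨
  toℚᵘ (fromℚᵘ (u ℚᵘ.* v))              ∎
  where open ℚᵘ.≃-Reasoning

fromℚᵘ-homo-+ : ∀ u v → fromℚᵘ u ℚ.+ fromℚᵘ v ≡ fromℚᵘ (u ℚᵘ.+ v)
fromℚᵘ-homo-+ u v = ℚ.toℚᵘ-injective $ begin
  toℚᵘ (fromℚᵘ u ℚ.+ fromℚᵘ v)          ≈⟨ ℚ.toℚᵘ-homo-+ (fromℚᵘ u) (fromℚᵘ v) ⟩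
  toℚᵘ (fromℚᵘ u) ℚᵘ.+ toℚᵘ (fromℚᵘ v)  ≈⟨ ℚᵘ.+-cong (ℚ.toℚᵘ-fromℚᵘ u) (ℚ.toℚᵘ-fromℚᵘ v) ⟩
  u ℚᵘ.+ v                              ≈⟨ ℚ.toℚᵘ-fromℚᵘ (u ℚᵘ.+ v) ⟨
  toℚᵘ (fromℚᵘ (u ℚᵘ.+ v))              ∎
  where open ℚᵘ.≃-Reasoning

i/n*n/1≡i/1 : ∀ i n .{{_ : ℕ.NonZero n}} → (i ℚ./ n) ℚ.* (+ n ℚ./ 1) ≡ i ℚ./ 1
i/n*n/1≡i/1 i n@(suc n-1) = trans (fromℚᵘ-homo-* (mkℚᵘ i n-1) (mkℚᵘ (+ n) 0))
  (ℚ.fromℚᵘ-cong {mkℚᵘ i n-1 ℚᵘ.* mkℚᵘ (+ n) 0} {mkℚᵘ i 0} (*≡* (solve i (+ n))))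
  where
  solve : ∀ i n → i ℤ.* n ℤ.* 1ℤ ≡ i ℤ.* (n ℤ.* 1ℤ)
  solve = ℤ-Solver.solve-∀

i/1*j/1≡[i*j]/1 : ∀ i j → (i ℚ./ 1) ℚ.* (j ℚ./ 1) ≡ (i ℤ.* j) ℚ./ 1
i/1*j/1≡[i*j]/1 i j = fromℚᵘ-homo-* (mkℚᵘ i 0) (mkℚᵘ j 0)

i/n+j/n≡[i+j]/n : ∀ i j n .{{_ : ℕ.NonZero n}} → (i ℚ./ n) ℚ.+ (j ℚ./ n) ≡ (i ℤ.+ j) ℚ./ n
i/n+j/n≡[i+j]/n i j n@(suc n-1) = trans (fromℚᵘ-homo-+ (mkℚᵘ i n-1) (mkℚᵘ j n-1))
  (ℚ.fromℚᵘ-cong {mkℚᵘ i n-1 ℚᵘ.+ mkℚᵘ j n-1} {mkℚᵘ (i ℤ.+ j) n-1} (*≡* (solve i j (+ n))))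
  where
  solve : ∀ i j n → (i ℤ.* n ℤ.+ j ℤ.* n) ℤ.* n ≡ (i ℤ.+ j) ℤ.* (n ℤ.* n)
  solve = ℤ-Solver.solve-∀

n/n≡1/1 : ∀ n .{{_ : ℕ.NonZero n}} → + n ℚ./ n ≡ 1ℤ ℚ./ 1
n/n≡1/1 n@(suc n-1) = ℚ.fromℚᵘ-cong {mkℚᵘ (+ n) n-1} {mkℚᵘ 1ℤ 0} (*≡* (ℤ.*-comm (+ n) 1ℤ))

n/1≢0 : ∀ n .{{_ : ℕ.NonZero n}} → + n ℚ./ 1 ≢ 0ℚ
n/1≢0 (suc n-1) eq with ℚ.fromℚᵘ-injective {mkℚᵘ (+ suc n-1) 0} {mkℚᵘ 0ℤ 0} eq
... | *≡* ()

-- With `a + d` for `n`, the number 1 is `n / n` and splits as `a / n` plus `d / n`.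
1-d/n : ∀ {a d n} .{{_ : ℕ.NonZero n}} → a + d ≡ n → (1ℤ ℚ./ 1) ℚ.- (+ d ℚ./ n) ≡ + a ℚ./ n
1-d/n {a} {d} {n} refl = begin
  (1ℤ ℚ./ 1) ℚ.- (+ d ℚ./ n)                     ≡⟨ cong (ℚ._- (+ d ℚ./ n)) (n/n≡1/1 n) ⟨
  (+ n ℚ./ n) ℚ.- (+ d ℚ./ n)                    ≡⟨ cong (ℚ._- (+ d ℚ./ n)) (i/n+j/n≡[i+j]/n (+ a) (+ d) n) ⟨
  ((+ a ℚ./ n) ℚ.+ (+ d ℚ./ n)) ℚ.- (+ d ℚ./ n)  ≡⟨ ℚ.+-assoc (+ a ℚ./ n) (+ d ℚ./ n) _ ⟩
  (+ a ℚ./ n) ℚ.+ ((+ d ℚ./ n) ℚ.- (+ d ℚ./ n))  ≡⟨ cong (+ a ℚ./ n ℚ.+_) (ℚ.+-inverseʳ (+ d ℚ./ n)) ⟩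
  (+ a ℚ./ n) ℚ.+ 0ℚ                             ≡⟨ ℚ.+-identityʳ (+ a ℚ./ n) ⟩
  + a ℚ./ n                                      ∎
  where open ≡-Reasoning

-- A quotient is certified by multiplying back, so callers name `r` and never handle inverses.
applyOp-divℚ : ∀ {p q r} → q ≢ 0ℚ → r ℚ.* q ≡ p → applyOp divℚ p q ≡ just r
applyOp-divℚ {p} {q} {r} q≢0 refl with q ℚ.≟ 0ℚ
... | yes q≡0 = contradiction q≡0 q≢0
... | no _    = cong just $ begin
  (r ℚ.* q) ℚ.* (ℚ.1/ q)  ≡⟨ ℚ.*-assoc r q (ℚ.1/ q) ⟩
  r ℚ.* (q ℚ.* (ℚ.1/ q))  ≡⟨ cong (r ℚ.*_) (ℚ.*-inverseʳ q) ⟩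
  r ℚ.* ℚ.1ℚ              ≡⟨ ℚ.*-identityʳ r ⟩
  r                       ∎
  where
  open ≡-Reasoning
  instance _ = ℚ.≢-nonZero q≢0

-- Program logic with bounds on time and memory

module _ {vars arrays : ℕ} where

  open Language vars arrays

  -- A memory bound read off the syntax alone. Successive commands reuse space, so iterations do not
  -- add up; the 2 stands for the loop counter and the upper bound.
  peak : Cmd → ℕ
  peak (x ≔ e)                       = temps e
  peak (c₁ ⨾ c₂)                     = peak c₁ ⊔ peak c₂
  peak (if e₁ < e₂ then c₁ else c₂)  = temps₂ e₁ e₂ ⊔ (peak c₁ ⊔ peak c₂)
  peak (for x from e₁ to e₂ loop c)  = temps₂ e₁ e₂ ⊔ (2 + peak c)
  peak break                         = 0
  peak (return e)                    = temps e

module Rules {vars arrays : ℕ} (inputs : Vec Array arrays) where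

  open Language vars arrays hiding (output)

  -- A record, because the bare equation would reduce and `e` and `σ` could not be inferred when
  -- rules are chained.
  record Evaluates {τ} (e : Expr τ) (σ : Store) (v : Val τ) : Set where
    constructor evaluates
    field
      result : eval inputs e σ ≡ just v

  -- Exact time and space depend on the path taken and are kept as fields; only the bound `T` is an
  -- index, and the rules add such bounds. Space needs no index, as `peak c` is determined by `c`.
  record Runs (c : Cmd) (σ : Store) (g : Signal) (σ′ : Store) (T : ℕ) : Set where
    constructor runs
    field
      {time space} : ℕ
      result       : exec inputs c σ ≡ just (outcome g σ′ time space)
      time≤        : time ≤ T
      space≤       : space ≤ peak c

  record Iterates (c : Cmd) (x : Fin vars) (n : ℕ) (v : ℤ) (σ : Store)
                  (g : Signal) (σ′ : Store) (T : ℕ) : Set where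
    constructor iterates
    field
      {time space} : ℕ
      result       : iterate (exec inputs c) x n v σ ≡ just (outcome g σ′ time space)
      time≤        : time ≤ T
      space≤       : space ≤ peak c

  Runs-mono : ∀ {c σ g σ′ T T′} → T ≤ T′ → Runs c σ g σ′ T → Runs c σ g σ′ T′
  Runs-mono T≤T′ (runs eq t≤ s≤) = runs eq (ℕ.≤-trans t≤ T≤T′) s≤

  Iterates-mono : ∀ {c x n v σ g σ′ T T′} → T ≤ T′ →
                  Iterates c x n v σ g σ′ T → Iterates c x n v σ g σ′ T′
  Iterates-mono T≤T′ (iterates eq t≤ s≤) = iterates eq (ℕ.≤-trans t≤ T≤T′) s≤

  eval-lit : ∀ {z σ} → Evaluates (lit z) σ z
  eval-lit = evaluates refl

  eval-var : ∀ {x σ} → Evaluates (var x) σ (lookup σ x)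
  eval-var = evaluates refl

  eval-sizeOf : ∀ {a σ} → Evaluates (sizeOf a) σ (+ Array.length (lookup inputs a))
  eval-sizeOf = evaluates refl

  eval-[] : ∀ {a e σ z v} → Evaluates e σ z → readArray (lookup inputs a) z ≡ just v →
            Evaluates (a [ e ]) σ v
  eval-[] (evaluates eq) eq′ = evaluates (trans (cong (_>>= _) eq) eq′)

  eval-abs : ∀ {e σ z} → Evaluates e σ z → Evaluates (abs e) σ (+ ℤ.∣ z ∣)
  eval-abs (evaluates eq) = evaluates (cong (_>>= _) eq)

  eval-↑ : ∀ {e σ z} → Evaluates e σ z → Evaluates (↑ e) σ (z ℚ./ 1)
  eval-↑ (evaluates eq) = evaluates (cong (_>>= _) eq)

  eval-bin : ∀ {τ} {op : Op τ} {e₁ e₂ σ x y z} → Evaluates e₁ σ x → Evaluates e₂ σ y →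
             applyOp op x y ≡ just z → Evaluates (bin op e₁ e₂) σ z
  eval-bin {op = op} {e₁} {e₂} {σ} {z = z} (evaluates eq₁) (evaluates eq₂) eq = evaluates eq′
    where
    eq′ : eval inputs (bin op e₁ e₂) σ ≡ just z
    eq′ rewrite eq₁ | eq₂ = eq

  run-≔ : ∀ {x e σ z} → Evaluates e σ z → Runs (x ≔ e) σ normal (σ [ x ]≔ z) (1 + cost e)
  run-≔ (evaluates eq) = runs (cong (_>>= _) eq) ℕ.≤-refl ℕ.≤-refl

  run-⨾ : ∀ {c₁ c₂ g σ σ′ σ″ T₁ T₂} → Runs c₁ σ normal σ′ T₁ → Runs c₂ σ′ g σ″ T₂ →
          Runs (c₁ ⨾ c₂) σ g σ″ (T₁ + T₂)
  run-⨾ {c₁} {c₂} {g} {σ} {σ″ = σ″} (runs {t₁} {m₁} eq₁ t₁≤ s₁≤) (runs {t₂} {m₂} eq₂ t₂≤ s₂≤) =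
    runs eq (ℕ.+-mono-≤ t₁≤ t₂≤) (ℕ.⊔-mono-≤ s₁≤ s₂≤)
    where
    eq : exec inputs (c₁ ⨾ c₂) σ ≡ just (outcome g σ″ (t₁ + t₂) (m₁ ⊔ m₂))
    eq rewrite eq₁ | eq₂ = refl

  run-then : ∀ {e₁ e₂ c₁ c₂ g σ σ′ x y T} → Evaluates e₁ σ x → Evaluates e₂ σ y →
             x ℤ.< y → Runs c₁ σ g σ′ T →
             Runs (if e₁ < e₂ then c₁ else c₂) σ g σ′ (1 + cost e₁ + cost e₂ + T)
  run-then {e₁} {e₂} {c₁} {c₂} {g} {σ} {σ′} {x} {y} (evaluates eq₁) (evaluates eq₂) x<y
           (runs {t} {m} eq t≤ s≤) =
    runs eq′ (ℕ.+-monoʳ-≤ (1 + cost e₁ + cost e₂) t≤)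
      (ℕ.⊔-monoʳ-≤ (temps₂ e₁ e₂) (ℕ.≤-trans s≤ (ℕ.m≤m⊔n _ _)))
    where
    eq′ : exec inputs (if e₁ < e₂ then c₁ else c₂) σ ≡
          just (outcome g σ′ (1 + cost e₁ + cost e₂ + t) (temps₂ e₁ e₂ ⊔ m))
    eq′ rewrite eq₁ | eq₂ | dec-true (x ℤ.<? y) x<y | eq = refl

  run-else : ∀ {e₁ e₂ c₁ c₂ g σ σ′ x y T} → Evaluates e₁ σ x → Evaluates e₂ σ y →
             x ℤ.≮ y → Runs c₂ σ g σ′ T →
             Runs (if e₁ < e₂ then c₁ else c₂) σ g σ′ (1 + cost e₁ + cost e₂ + T)
  run-else {e₁} {e₂} {c₁} {c₂} {g} {σ} {σ′} {x} {y} (evaluates eq₁) (evaluates eq₂) x≮y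
           (runs {t} {m} eq t≤ s≤) =
    runs eq′ (ℕ.+-monoʳ-≤ (1 + cost e₁ + cost e₂) t≤)
      (ℕ.⊔-monoʳ-≤ (temps₂ e₁ e₂) (ℕ.≤-trans s≤ (ℕ.m≤n⊔m _ _)))
    where
    eq′ : exec inputs (if e₁ < e₂ then c₁ else c₂) σ ≡
          just (outcome g σ′ (1 + cost e₁ + cost e₂ + t) (temps₂ e₁ e₂ ⊔ m))
    eq′ rewrite eq₁ | eq₂ | dec-false (x ℤ.<? y) x≮y | eq = refl

  run-break : ∀ {σ} → Runs break σ broken σ 0
  run-break = runs refl z≤n z≤n

  run-return : ∀ {e σ q} → Evaluates e σ q → Runs (return e) σ (returned q) σ (cost e)
  run-return (evaluates eq) = runs (cong (_>>= _) eq) ℕ.≤-refl ℕ.≤-refl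

  run-for : ∀ {x e₁ e₂ c g σ σ′ lo hi n T} → Evaluates e₁ σ lo → Evaluates e₂ σ hi →
            ℤ.∣ 0ℤ ℤ.⊔ (ℤ.suc hi ℤ.- lo) ∣ ≡ n → Iterates c x n lo σ g σ′ T →
            Runs (for x from e₁ to e₂ loop c) σ g σ′ (2 + cost e₁ + cost e₂ + T)
  run-for {x} {e₁} {e₂} {c} {g} {σ} {σ′} (evaluates eq₁) (evaluates eq₂) refl
          (iterates {t} {m} eq t≤ s≤) =
    runs eq′ (ℕ.+-monoʳ-≤ (2 + cost e₁ + cost e₂) t≤)
      (ℕ.⊔-monoʳ-≤ (temps₂ e₁ e₂) (ℕ.+-monoʳ-≤ 2 s≤))
    where
    eq′ : exec inputs (for x from e₁ to e₂ loop c) σ ≡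
          just (outcome g σ′ (2 + cost e₁ + cost e₂ + t) (temps₂ e₁ e₂ ⊔ (2 + m)))
    eq′ rewrite eq₁ | eq₂ | eq = refl

  iterate-done : ∀ {c x v σ} → Iterates c x zero v σ normal σ 1
  iterate-done = iterates refl ℕ.≤-refl z≤n

  iterate-next : ∀ {c x n v g σ σ′ σ″ T T′} → Runs c (σ [ x ]≔ v) normal σ′ T →
                 Iterates c x n (ℤ.suc v) σ′ g σ″ T′ →
                 Iterates c x (suc n) v σ g σ″ (4 + T + T′)
  iterate-next {c} {x} {n} {v} {g} {σ} {σ″ = σ″} (runs {t} {m} eq t≤ s≤)
               (iterates {t′} {m′} eq′ t′≤ s′≤) =
    iterates eq″ (ℕ.+-monoʳ-≤ 4 (ℕ.+-mono-≤ t≤ t′≤)) (ℕ.⊔-lub s≤ s′≤)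
    where
    eq″ : iterate (exec inputs c) x (suc n) v σ ≡ just (outcome g σ″ (4 + t + t′) (m ⊔ m′))
    eq″ rewrite eq | eq′ = refl

  iterate-break : ∀ {c x n v σ σ′ T} → Runs c (σ [ x ]≔ v) broken σ′ T →
                  Iterates c x (suc n) v σ normal σ′ (2 + T)
  iterate-break {c} {x} {n} {v} {σ} {σ′} (runs {t} {m} eq t≤ s≤) = iterates eq′ (ℕ.+-monoʳ-≤ 2 t≤) s≤
    where
    eq′ : iterate (exec inputs c) x (suc n) v σ ≡ just (outcome normal σ′ (2 + t) m)
    eq′ rewrite eq = refl

  run-program : ∀ {c q σ T} → Runs c (replicate vars 0ℤ) (returned q) σ T →
    ∃[ time ] ∃[ memory ]
      (run inputs c ≡ just (Language.output q time memory) × time ≤ T × memory ≤ vars + peak c)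
  run-program {c} {q} (runs {t} {m} eq t≤ s≤) = t , vars + m , eq′ , t≤ , ℕ.+-monoʳ-≤ vars s≤
    where
    eq′ : run inputs c ≡ just (Language.output q t (vars + m))
    eq′ rewrite eq = refl

-- The procedure RICPD

module Loops where
  open Language 8 2
  open RICPD

  -- The two loop bodies of `program`, which does not name them.
  innerBody outerBody : Cmd
  innerBody =
    m ≔ minₑ (C₁ [ i+1 ]) (C₂ [ j+1 ]) ⊖ maxₑ (C₁ [ var i ]) (C₂ [ var j ]) ⨾
    m ≔ maxₑ (lit 0ℤ) (var m) ⨾
    d ≔ var d ⊕ var m ⊗ abs (C₁ [ i+1 ] ⊖ C₂ [ j+1 ]) ⨾
    (if C₁ [ i+1 ] < C₂ [ j+1 ]
      then break
      else (b ≔ j+1))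
  outerBody = for j from var b to var s ⊖ one loop innerBody

-- Clipping at 0 is truncated subtraction; this turns the value the program stores in `m` into
-- `width`.
0⊔[m-n]≡m∸n : ∀ m n → 0ℤ ℤ.⊔ (+ m ℤ.- + n) ≡ + (m ∸ n)
0⊔[m-n]≡m∸n m n with ℕ.≤-total n m
... | inj₁ n≤m rewrite ℤ.m-n≡m⊖n m n | ℤ.⊖-≥ n≤m = refl
... | inj₂ m≤n rewrite ℤ.m-n≡m⊖n m n | ℤ.⊖-≤ m≤n | ℕ.m≤n⇒m∸n≡0 m≤n = ℤ.i≥j⇒i⊔j≡i (ℤ.neg-≤-pos {n ∸ m} {0})

∣+m-+n∣≡∣m-n∣ : ∀ m n → ℤ.∣ + m ℤ.- + n ∣ ≡ ∣ m - n ∣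
∣+m-+n∣≡∣m-n∣ m n with ℕ.≤-total n m
... | inj₁ n≤m rewrite ℤ.m-n≡m⊖n m n | ℤ.⊖-≥ n≤m = sym (ℕ.m≤n⇒∣n-m∣≡n∸m n≤m)
... | inj₂ m≤n rewrite ℤ.m-n≡m⊖n m n = trans (ℤ.∣⊖∣-≤ m≤n) (sym (ℕ.m≤n⇒∣m-n∣≡n∸m m≤n))

-- The upper bound `k - 1` is inclusive, so the loop takes the `n` values from `m` to `k - 1`.
-- Writing `k` as `m + n` avoids truncated subtraction.
trip-count : ∀ {m n k} → m + n ≡ k → ℤ.∣ 0ℤ ℤ.⊔ (ℤ.suc (+ k ℤ.- 1ℤ) ℤ.- + m) ∣ ≡ n
trip-count {m} {n} refl = begin
  ℤ.∣ 0ℤ ℤ.⊔ (ℤ.suc (+ (m + n) ℤ.- 1ℤ) ℤ.- + m) ∣ ≡⟨ cong (λ z → ℤ.∣ 0ℤ ℤ.⊔ z ∣) (solve (+ m) (+ n)) ⟩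
  n                                               ∎
  where
  open ≡-Reasoning
  solve : ∀ i j → 1ℤ ℤ.+ (i ℤ.+ j ℤ.- 1ℤ) ℤ.- i ≡ j
  solve = ℤ-Solver.solve-∀

module Correctness {N r s : ℕ} {A₁ : Vector ℤ (suc r)} {A₂ : Vector ℤ (suc s)}
                   (cp₁ : IsChangePoints N A₁) (cp₂ : IsChangePoints N A₂) where

  open Agreement cp₁ cp₂
  open Language 8 2 hiding (output; Output)
  open Rules {8} {2} (array A₁ ∷ array A₂ ∷ [])
  open Loops

  private
    module E₁ = ChangePoints cp₁
    module E₂ = ChangePoints cp₂
    inputs = array A₁ ∷ array A₂ ∷ []
    c e : ℕ → ℕ
    c = boundary A₁
    e = boundary A₂
    total = remaining 0

  state : (d b : ℕ) (i j m n : ℤ) → Store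
  state d b i j m n = + r ∷ + s ∷ + d ∷ + b ∷ i ∷ j ∷ m ∷ n ∷ []

  width : ℕ → ℕ → ℕ
  width i j = (c (suc i) ⊓ e (suc j)) ∸ (c i ⊔ e j)

  gap : ℕ → ℕ → ℕ
  gap i j = ∣ c (suc i) - e (suc j) ∣

  module _ {i j : ℕ} (i<r : i < r) (j<s : j < s) {d b : ℕ} {m n : ℤ} where

    private
      σ = state d b (+ i) (+ j) m n

    eval-C₁[i+1] : Evaluates (0F [ RICPD.i+1 ]) σ (+ c (suc i))
    eval-C₁[i+1] = eval-[] (eval-bin eval-var eval-lit (cong (just ∘ +_) (ℕ.+-comm i 1))) (E₁.reads i<r)

    eval-C₂[j+1] : Evaluates (1F [ RICPD.j+1 ]) σ (+ e (suc j))
    eval-C₂[j+1] = eval-[] (eval-bin eval-var eval-lit (cong (just ∘ +_) (ℕ.+-comm j 1))) (E₂.reads j<s)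

    eval-overlap : Evaluates
      (minₑ (0F [ RICPD.i+1 ]) (1F [ RICPD.j+1 ]) ⊖ maxₑ (0F [ var RICPD.i ]) (1F [ var RICPD.j ])) σ
      (+ (c (suc i) ⊓ e (suc j)) ℤ.- + (c i ⊔ e j))
    eval-overlap = eval-bin
      (eval-bin eval-C₁[i+1] eval-C₂[j+1] refl)
      (eval-bin (eval-[] eval-var (E₁.reads (ℕ.<⇒≤ i<r)))
                    (eval-[] eval-var (E₂.reads (ℕ.<⇒≤ j<s))) refl)
      refl

    eval-contribution : ∀ {w} → m ≡ + w → Evaluates
      (var RICPD.d ⊕ var RICPD.m ⊗ abs (0F [ RICPD.i+1 ] ⊖ 1F [ RICPD.j+1 ])) σ
      (+ (d + w * gap i j))
    eval-contribution {w} refl = eval-bin eval-var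
      (eval-bin eval-var (eval-abs (eval-bin eval-C₁[i+1] eval-C₂[j+1] refl)) refl)
      (cong (λ z → just (+ d ℤ.+ z)) (begin
        + w ℤ.* + ℤ.∣ + c (suc i) ℤ.- + e (suc j) ∣  ≡⟨ cong (λ k → + w ℤ.* + k) (∣+m-+n∣≡∣m-n∣ (c (suc i)) (e (suc j))) ⟩
        + w ℤ.* + gap i j                            ≡⟨ ℤ.pos-* w (gap i j) ⟨
        + (w * gap i j)                              ∎))
      where open ≡-Reasoning

  module _ {i j : ℕ} (i<r : i < r) (j<s : j < s) {d : ℕ} {m n : ℤ} where

    private
      d′ = d + width i j * gap i j

    -- The variable `b` equals `j` whenever the body starts. A break keeps it there, so the next row
    -- resumes at this column; otherwise `b` moves to `suc j`, as `j` will.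
    run-innerBody-break : c (suc i) < e (suc j) →
      Runs innerBody (state d j (+ i) (+ j) m n) broken (state d′ j (+ i) (+ j) (+ width i j) n) 28
    -- The three assignments and the comparison cost 10, 2, 9 and 5. The other branch adds 2 for
    -- `b ≔ j+1`, hence the common bound 28.
    run-innerBody-break c<e = Runs-mono (ℕ.≤ᵇ⇒≤ 26 28 _) $
      run-⨾ (run-≔ (eval-overlap i<r j<s)) $
      run-⨾ (run-≔ (eval-bin eval-lit eval-var (cong just (0⊔[m-n]≡m∸n (c (suc i) ⊓ e (suc j)) (c i ⊔ e j))))) $
      run-⨾ (run-≔ (eval-contribution i<r j<s refl)) $
      run-then (eval-C₁[i+1] i<r j<s) (eval-C₂[j+1] i<r j<s) (ℤ.+<+ c<e) run-break

    run-innerBody-next : e (suc j) ≤ c (suc i) →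
      Runs innerBody (state d j (+ i) (+ j) m n) normal (state d′ (suc j) (+ i) (+ j) (+ width i j) n) 28
    run-innerBody-next e≤c =
      run-⨾ (run-≔ (eval-overlap i<r j<s)) $
      run-⨾ (run-≔ (eval-bin eval-lit eval-var (cong just (0⊔[m-n]≡m∸n (c (suc i) ⊓ e (suc j)) (c i ⊔ e j))))) $
      run-⨾ (run-≔ (eval-contribution i<r j<s refl)) $
      run-else (eval-C₁[i+1] i<r j<s) (eval-C₂[j+1] i<r j<s) (ℕ.≤⇒≯ e≤c ∘ ℤ.drop‿+<+)
        (run-≔ (eval-bin eval-var eval-lit (cong (just ∘ +_) (ℕ.+-comm j 1))))

  -- An inner iteration takes at most 4 + 28 operations: 28 for the body and 4 for
  -- the loop control; a row ends with a break (2 + 28) or an exhausted loop (1).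
  record InnerResult (i j n d : ℕ) (j₀ m N′ : ℤ) : Set where
    field
      {d′ j′ steps} : ℕ
      {j₁ m′}       : ℤ
      steps+j≡j′    : steps + j ≡ j′
      j′≤s          : j′ ≤ s
      iterations    : Iterates innerBody RICPD.j n (+ j) (state d j (+ i) j₀ m N′) normal
                               (state d′ j′ (+ i) j₁ m′ N′) (32 * steps + 30)
      invariant     : d′ + remaining (c (suc i)) ≡ total
      e≤c           : e j′ ≤ c (suc i)
      c≤e           : j′ < s → c (suc i) ≤ e (suc j′)

  -- The sweep stands at `c i ⊔ e j`, and `d` counts the disagreeing pairs whose smaller point lies
  -- before it. By `remaining-block` an iteration moves the sweep to the nearer block end. If the
  -- row ends strictly first, the loop breaks; otherwise the next overlap starts there. The bound on
  -- `c i` is conditional on `j < s` because past the last column `e` has its junk value 0.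
  inner : ∀ n {i j d j₀ m N′} → i < r → j + n ≡ s →
          (j < s → c i ≤ e (suc j)) → e j ≤ c (suc i) → d + remaining (c i ⊔ e j) ≡ total →
          InnerResult i j n d j₀ m N′
  inner zero {i} {j} {d} i<r j+0≡s _ e≤c inv = record
    { steps+j≡j′ = refl
    ; j′≤s       = ℕ.≤-reflexive j≡s
    ; iterations = Iterates-mono (s≤s z≤n) iterate-done
    ; invariant  = subst (λ p → d + remaining p ≡ total) (trans (ℕ.m≤n⇒m⊔n≡n c≤ej) e≡c) inv
    ; e≤c        = e≤c
    ; c≤e        = λ j<s → contradiction j≡s (ℕ.<⇒≢ j<s)
    }
    where
    j≡s : j ≡ s
    j≡s = trans (sym (ℕ.+-identityʳ j)) j+0≡s
    ej≡N : e j ≡ N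
    ej≡N = trans (cong e j≡s) E₂.boundary-last
    -- With the columns exhausted, `N` is `e j`, which is at most `c (suc i)`, itself at most `N`:
    -- this row ends at `N` too.
    e≡c : e j ≡ c (suc i)
    e≡c = ℕ.≤-antisym e≤c (subst (c (suc i) ≤_) (sym ej≡N) (E₁.boundary≤N i<r))
    c≤ej : c i ≤ e j
    c≤ej = subst (c i ≤_) (sym e≡c) (E₁.boundary-≤ i<r)
  inner (suc n) {i} {j} {d} {N′ = N′} i<r j+n≡s c≤e e≤c inv = continue (c (suc i) <? e (suc j))
    where
    j<s : j < s
    j<s = subst (j <_) j+n≡s (ℕ.m<m+n j (s≤s z≤n))

    inv′ : d + width i j * gap i j + remaining (c (suc i) ⊓ e (suc j)) ≡ total
    inv′ = trans (ℕ.+-assoc d _ _)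
             (trans (cong (λ p → d + p) (sym (remaining-block i<r j<s (c≤e j<s) e≤c))) inv)

    continue : Dec (c (suc i) < e (suc j)) → InnerResult i j (suc n) d _ _ N′
    continue (yes c<e) = record
      { steps+j≡j′ = refl
      ; j′≤s       = ℕ.<⇒≤ j<s
      ; iterations = iterate-break (run-innerBody-break i<r j<s c<e)
      ; invariant  = subst (λ p → d + width i j * gap i j + remaining p ≡ total)
                       (ℕ.m≤n⇒m⊓n≡m (ℕ.<⇒≤ c<e)) inv′
      ; e≤c        = e≤c
      ; c≤e        = λ _ → ℕ.<⇒≤ c<e
      }
    continue (no c≮e) = record
      { steps+j≡j′ = trans (sym (ℕ.+-suc _ j)) Next.steps+j≡j′
      ; j′≤s       = Next.j′≤s
      ; iterations = Iterates-mono (ℕ.≤-reflexive (solve Next.steps))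
                       (iterate-next (run-innerBody-next i<r j<s e≤c′) Next.iterations)
      ; invariant  = Next.invariant
      ; e≤c        = Next.e≤c
      ; c≤e        = Next.c≤e
      }
      where
      e≤c′ : e (suc j) ≤ c (suc i)
      e≤c′ = ℕ.≮⇒≥ c≮e
      module Next = InnerResult (inner n i<r (trans (sym (ℕ.+-suc j n)) j+n≡s)
        (λ j<s′ → ℕ.≤-trans (c≤e j<s) (E₂.boundary-≤ j<s′)) e≤c′
        -- The nearer end `e (suc j)` is also the later of the two starts at the next column, since
        -- `c i ≤ e (suc j)`.
        (subst (λ p → d + width i j * gap i j + remaining p ≡ total)
          (trans (ℕ.m≥n⇒m⊓n≡n e≤c′) (sym (ℕ.m≤n⇒m⊔n≡n (c≤e j<s)))) inv′))
      solve : ∀ t → 4 + 28 + (32 * t + 30) ≡ 32 * suc t + 30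
      solve = solve-∀

  -- Besides its inner iterations, a row takes 4 + 3 + 30 operations: 3 to enter
  -- the inner loop and 30 to leave it.
  record OuterResult (i j n d : ℕ) (i₀ j₀ m N′ : ℤ) : Set where
    field
      {b′ steps}    : ℕ
      {i₁ j₁ m′}    : ℤ
      steps+j≤s     : steps + j ≤ s
      iterations    : Iterates outerBody RICPD.i n (+ i) (state d j i₀ j₀ m N′) normal
                               (state total b′ i₁ j₁ m′ N′) (37 * n + 32 * steps + 1)

  -- Columns never move back, so the inner steps of all rows together number at most `s ∸ j`; this
  -- makes the nested loops linear. What one row guarantees on exit is what the next requires on
  -- entry.
  outer : ∀ n {i j d i₀ j₀ m N′} → i + n ≡ r → j ≤ s →
          (j < s → c i ≤ e (suc j)) → e j ≤ c i → d + remaining (c i) ≡ total →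
          OuterResult i j n d i₀ j₀ m N′
  outer zero {i} {j} {d} {i₀} {j₀} {m} {N′} i+0≡r j≤s _ _ inv = record
    { steps+j≤s  = j≤s
    ; iterations = subst (λ d′ → Iterates outerBody RICPD.i 0 (+ i) (state d j i₀ j₀ m N′) normal
                     (state d′ j i₀ j₀ m N′) 1) d≡total iterate-done
    }
    where
    c≡N : c i ≡ N
    c≡N = trans (cong c (trans (sym (ℕ.+-identityʳ i)) i+0≡r)) E₁.boundary-last
    -- After the last row the sweep stands at `N`, with nothing left to count.
    d≡total : d ≡ total
    d≡total = begin
      d                   ≡⟨ ℕ.+-identityʳ d ⟨
      d + 0               ≡⟨ cong (λ p → d + p) (trans (cong remaining c≡N) remaining-N) ⟨
      d + remaining (c i) ≡⟨ inv ⟩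
      total               ∎
      where open ≡-Reasoning
  outer (suc n) {i} {j} {d} i+n≡r j≤s c≤e e≤c inv = record
    { steps+j≤s  = ℕ.≤-trans (ℕ.≤-reflexive
                     (trans (ℕ.+-assoc Rest.steps Row.steps j) (cong (λ k → Rest.steps + k) Row.steps+j≡j′)))
                     Rest.steps+j≤s
    ; iterations = Iterates-mono (ℕ.≤-reflexive (solve n Row.steps Rest.steps)) $
        iterate-next
          (run-for eval-var (eval-bin eval-var eval-lit refl) (trip-count (ℕ.m+[n∸m]≡n j≤s)) Row.iterations)
          Rest.iterations
    }
    where
    i<r : i < r
    i<r = subst (i <_) i+n≡r (ℕ.m<m+n i (s≤s z≤n))
    module Row = InnerResult (inner (s ∸ j) {i} {j} {d} {N′ = _} i<r (ℕ.m+[n∸m]≡n j≤s) c≤e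
      (ℕ.≤-trans e≤c (E₁.boundary-≤ i<r))
      -- As `e j ≤ c i`, the sweep enters the row at `c i`.
      (subst (λ p → d + remaining p ≡ total) (sym (ℕ.m≥n⇒m⊔n≡m e≤c)) inv))
    module Rest = OuterResult (outer n (trans (sym (ℕ.+-suc i n)) i+n≡r)
      Row.j′≤s Row.c≤e Row.e≤c Row.invariant)
    solve : ∀ n t t′ → 4 + (2 + 0 + 1 + (32 * t + 30)) + (37 * n + 32 * t′ + 1)
                        ≡ 37 * suc n + 32 * (t′ + t) + 1
    solve = solve-∀

  -- The returned value and the total running time

  private
    P₁ = clustering cp₁
    P₂ = clustering cp₂

  N₀₀+N₁₁+total≡NC2 : N₀₀ P₁ P₂ + N₁₁ P₁ P₂ + total ≡ N C 2
  N₀₀+N₁₁+total≡NC2 = trans (cong (λ t → N₀₀ P₁ P₂ + N₁₁ P₁ P₂ + t) remaining-zero) N₀₀+N₁₁+∑distance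

  -- The two quotients are `N C 2`, certified by doubling, and `total` over `N C 2`, which `2≤N`
  -- makes a legal division. Subtracting the latter from 1 leaves the share of agreeing pairs.
  eval-RandIndex : ∀ (2≤N : 2 ≤ N) {b i j m} → Evaluates
    ((↑ RICPD.one) ⊝ (↑ var RICPD.d) ⊘ RICPD.binom) (state total b i j m (+ N))
    (RandIndex 2≤N P₁ P₂)
  eval-RandIndex 2≤N = eval-bin (eval-↑ eval-lit)
    (eval-bin (eval-↑ eval-var)
      (eval-bin (eval-↑ (eval-bin eval-var (eval-bin eval-var eval-lit refl) refl)) (eval-↑ eval-lit)
        (applyOp-divℚ {r = + (N C 2) ℚ./ 1} (n/1≢0 2) double))
      (applyOp-divℚ {r = + total ℚ./ (N C 2)} (n/1≢0 (N C 2)) (i/n*n/1≡i/1 (+ total) (N C 2))))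
    (cong just (1-d/n {N₀₀ P₁ P₂ + N₁₁ P₁ P₂} {total} {N C 2} N₀₀+N₁₁+total≡NC2))
    where
    instance _ = nC2-nonZero 2≤N
    double : (+ (N C 2) ℚ./ 1) ℚ.* (+ 2 ℚ./ 1) ≡ (+ N ℤ.* (+ N ℤ.- 1ℤ)) ℚ./ 1
    double = trans (i/1*j/1≡[i*j]/1 (+ (N C 2)) (+ 2)) (cong (ℚ._/ 1) (begin
      + (N C 2) ℤ.* + 2       ≡⟨ ℤ.pos-* (N C 2) 2 ⟨
      + ((N C 2) * 2)         ≡⟨ cong +_ (nC2*2≡n*[n∸1] N) ⟩
      + (N * (N ∸ 1))         ≡⟨ ℤ.pos-* N (N ∸ 1) ⟩
      + N ℤ.* + (N ∸ 1)       ≡⟨ cong (+ N ℤ.*_) (trans (ℤ.m-n≡m⊖n N 1) (ℤ.⊖-≥ (ℕ.<⇒≤ 2≤N))) ⟨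
      + N ℤ.* (+ N ℤ.- 1ℤ)    ∎))
      where open ≡-Reasoning

  run-RICPD : (2≤N : 2 ≤ N) → 1 ≤ r → ∃[ σ ]
    Runs RICPD.program (replicate 8 0ℤ) (returned (RandIndex 2≤N P₁ P₂)) σ (56 * (r + s))
  run-RICPD 2≤N 1≤r = _ , Runs-mono bound (
    run-⨾ (run-≔ (eval-bin eval-sizeOf eval-lit refl)) $
    run-⨾ (run-≔ (eval-bin eval-sizeOf eval-lit refl)) $
    run-⨾ (run-≔ eval-lit) $
    run-⨾ (run-≔ eval-lit) $
    run-⨾ (run-for eval-lit (eval-bin eval-var eval-lit refl) (trip-count {0} refl) Loop.iterations) $
    run-⨾ (run-≔ (eval-[] eval-var (trans (E₁.reads ℕ.≤-refl) (cong (just ∘ +_) E₁.boundary-last))))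
    (run-return (eval-RandIndex 2≤N)))
    where
    module Loop = OuterResult (outer r {0} {0} {0} {0ℤ} {0ℤ} {0ℤ} {0ℤ} refl z≤n
      (λ _ → ℕ.≤-trans (ℕ.≤-reflexive E₁.boundary-zero) z≤n)
      (ℕ.≤-trans (ℕ.≤-reflexive E₂.boundary-zero) z≤n)
      (cong remaining E₁.boundary-zero))
    -- The constants come from the four initial assignments, loop entry, the last loop test, `N` and
    -- the returned expression. They sum to 19, absorbed by `19 * r`, so 56 is 19 + 37.
    bound : 3 + (3 + (1 + (1 + (3 + (37 * r + 32 * Loop.steps + 1) + (2 + 5))))) ≤ 56 * (r + s)
    bound = begin
      3 + (3 + (1 + (1 + (3 + (37 * r + 32 * Loop.steps + 1) + (2 + 5)))))
        ≡⟨ regroup r Loop.steps ⟩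
      19 * 1 + (37 * r + 32 * Loop.steps)
        ≤⟨ ℕ.+-mono-≤ (ℕ.*-monoʳ-≤ 19 1≤r)
             (ℕ.+-monoʳ-≤ (37 * r) (ℕ.*-monoʳ-≤ 32 (ℕ.m+n≤o⇒m≤o Loop.steps Loop.steps+j≤s))) ⟩
      19 * r + (37 * r + 32 * s)
        ≤⟨ ℕ.m≤m+n _ (24 * s) ⟩
      19 * r + (37 * r + 32 * s) + 24 * s
        ≡⟨ collect r s ⟩
      56 * (r + s) ∎
      where
      open ℕ.≤-Reasoning
      regroup : ∀ r t → 3 + (3 + (1 + (1 + (3 + (37 * r + 32 * t + 1) + (2 + 5))))) ≡ 19 * 1 + (37 * r + 32 * t)
      regroup = solve-∀
      collect : ∀ r s → 19 * r + (37 * r + 32 * s) + 24 * s ≡ 56 * (r + s)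
      collect = solve-∀

mainTheorem2 : ∃[ K ] ∃[ M ]
    ((N r s : ℕ) (2≤N : 2 ≤ N) → 1 ≤ r → 1 ≤ s →
    (C₁ : Vector ℤ (suc r)) (C₂ : Vector ℤ (suc s))
    (cp₁ : IsChangePoints N C₁) (cp₂ : IsChangePoints N C₂) →
    ∃[ time ] ∃[ memory ]
    (runRICPD C₁ C₂ ≡ just (output (RandIndex 2≤N (clustering cp₁) (clustering cp₂)) time memory)
    × time ≤ K * (r + s)
    × memory ≤ M))
-- The memory bound is the 8 variables plus the peak of the program text, hence independent of the
-- input.
mainTheorem2 = 56 , 8 + peak RICPD.program ,
  λ N r s 2≤N 1≤r _ C₁ C₂ cp₁ cp₂ →
    Rules.run-program {8} {2} (array C₁ ∷ array C₂ ∷ []) (proj₂ (Correctness.run-RICPD cp₁ cp₂ 2≤N 1≤r))
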